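{- Let $n,m,\ell$ be positive integers with $m\le n-1$ and $\ell\le n-1$. Then $$\sum_{j=0}^{n-m-1}\binom{m-\ell+2j}{j}\,\mathcal Y_n\big(2^{\{n-m-j-1\}},1^{\{m-\ell+2j\}}\big)=\frac{1}{n^2}\binom{n}{m}\binom{n}{\ell}.$$
   Context: Let $\zeta_n=e^{2\pi\sqrt{ -1}/n}$. For positive integers $s_1,\dots,s_m$, define $\mathfrak Z_n(s_1,\dots,s_m):=\sum_{1\le i_1<\cdots<i_m\le n-1}\prod_{k=1}^{m}(1-\zeta_n^{i_k})^{ -s_k}$ (equal to $1$ if $m=0$ and to $0$ if $m>n-1$). Define $\mathcal Y_n(s_1,\dots,s_m):=\sum_{\sigma}\mathfrak Z_n(\sigma)$, where $\sigma$ runs over all distinct rearrangements of $(s_1,\dots,s_m)$; $\mathcal Y_n$ of the empty sequence is $1$. Notation: $a^{\{k\}}$ denotes the block $a,\dots,a$ of length $k$; any $\mathcal Y_n$ term in which some block has negative length is interpreted as $0$. Binomial coefficients $\binom{a}{b}$ are $0$ when $b<0$ or $b>a\ge0$. -}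

module Defs where

open import Level using (_⊔_)
open import Algebra.Apartness.Bundles using (HeytingCommutativeRing; HeytingField)
open import Algebra.Bundles using (CommutativeRing; Semiring)
open import Data.Fin.Base using (Fin; toℕ)
open import Data.Fin.Properties using (toℕ<n)
open import Data.Integer.Base as ℤ using (ℤ; +_; -[1+_])
open import Data.List.Base
  using (List; []; _∷_; [_]; _++_; map; foldr; concatMap; zipWith; length;
         replicate; allFin; deduplicate)
open import Data.List.Properties using (≡-dec)
open import Data.Nat.Base as ℕ using (ℕ; zero; suc; _∸_; _<_; z<s; s<s)
open import Data.Nat.Combinatorics using (_C_)
import Data.Nat.Properties as ℕ
open import Data.Product.Base using (proj₁)

-- The sublists of length k, in order.  For the list 1, …, N these are the
-- sequences 1 ≤ i₁ < ⋯ < iₖ ≤ N.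
combinations : ∀ {a} {A : Set a} → ℕ → List A → List (List A)
combinations zero    _        = [ [] ]
combinations (suc k) []       = []
combinations (suc k) (x ∷ xs) =
  map (x ∷_) (combinations k xs) ++ combinations (suc k) xs

insertions : ∀ {a} {A : Set a} → A → List A → List (List A)
insertions x []       = [ [ x ] ]
insertions x (y ∷ ys) = (x ∷ y ∷ ys) ∷ map (y ∷_) (insertions x ys)

-- All length! permutations, with repetitions if entries coincide.
permutations : ∀ {a} {A : Set a} → List A → List (List A)
permutations []       = [ [] ]
permutations (x ∷ xs) = concatMap (insertions x) (permutations xs)

distinctRearrangements : List ℕ → List (List ℕ)
distinctRearrangements s = deduplicate (≡-dec ℕ._≟_) (permutations s)

-- a(a-1)⋯(a-b+1)/b! for every integer a; for negative upper argument this is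
-- C(-(a+1), b) = (-1)ᵇ C(a+b, b).
binomial : ℤ → ℕ → ℤ
binomial (+ a)    b = + (a C b)
binomial -[1+ a ] b = (ℤ.-1ℤ ℤ.^ b) ℤ.* (+ ((a ℕ.+ b) C b))

-- Fields are Heyting fields, so that the complex numbers are an instance
-- constructively: being apart, x # y, is what makes x - y invertible.
module FieldDefs {c ℓ₁ ℓ₂} (K : HeytingField c ℓ₁ ℓ₂) where

  open HeytingField K
  open CommutativeRing (HeytingCommutativeRing.commutativeRing heytingCommutativeRing)
    using (semiring)
  open Semiring semiring using (rawSemiring)
  open import Algebra.Definitions.RawSemiring rawSemiring public
    using (_×_; _^_)

  infixr 8 _·_

  _·_ : ℤ → Carrier → Carrier
  (+ k)    · x = k × x
  -[1+ k ] · x = - (suc k × x)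

  ∑ : ∀ {a} {A : Set a} → List A → (A → Carrier) → Carrier
  ∑ xs f = foldr _+_ 0# (map f xs)

  infix 3 ∑
  syntax ∑ xs (λ x → e) = ∑[ x ∈ xs ] e

  ∏ : List Carrier → Carrier
  ∏ = foldr _*_ 1#

  -- (x - y)⁻¹
  recip : ∀ {x y} → x # y → Carrier
  recip x#y = proj₁ (#⇒invertible x#y)

  CharacteristicZero : Set ℓ₂
  CharacteristicZero = ∀ n → 0 < n → n × 1# # 0#

  -- No exponential is available, so ζ stands for an arbitrary primitive n-th
  -- root of unity, such as e^(2πi/n) in ℂ.
  record IsPrimitiveRoot (n : ℕ) (ζ : Carrier) : Set (ℓ₁ ⊔ ℓ₂) where
    field
      ζⁿ≈1 : ζ ^ n ≈ 1#
      ζⁱ#1 : ∀ i → 0 < i → i < n → ζ ^ i # 1#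

  module MultipleSums {n : ℕ} {ζ : Carrier} (ζ-prim : IsPrimitiveRoot n ζ) where

    open IsPrimitiveRoot ζ-prim

    private
      suc<n : ∀ n {i} → i < n ∸ 1 → suc i < n
      suc<n (suc n) i<n = s<s i<n

    -- (1 - ζⁱ)⁻¹ for 1 ≤ i ≤ n - 1, where k : Fin (n ∸ 1) stands for the
    -- index i = k + 1.
    term : Fin (n ∸ 1) → Carrier
    term k = recip (#-sym (ζⁱ#1 (suc (toℕ k)) z<s (suc<n n (toℕ<n k))))

    ℨ : List ℕ → Carrier
    ℨ s = ∑[ is ∈ combinations (length s) (allFin (n ∸ 1)) ]
            ∏ (zipWith (λ i sₖ → term i ^ sₖ) is s)

    𝒴 : List ℕ → Carrier
    𝒴 s = ∑[ σ ∈ distinctRearrangements s ] ℨ σ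

    -- 𝒴 (2^{a}, 1^{b}), which is 0 if a block has negative length.
    𝒴[2^_,1^_] : ℤ → ℤ → Carrier
    𝒴[2^ + a      ,1^ + b      ] = 𝒴 (replicate a 2 ++ replicate b 1)
    𝒴[2^ + a      ,1^ -[1+ b ] ] = 0#
    𝒴[2^ -[1+ a ] ,1^ b        ] = 0#

-- The sum on the left is the expansion of the product eₚ e_q of elementary
-- symmetric polynomials into monomial symmetric polynomials m_(2ᵃ,1ᵇ), with
-- p = n−1−m and q = n−1−ℓ, evaluated at xᵢ = (1 − ζⁱ)⁻¹.  From xᵢ − 1 = xᵢ ζⁱ, the
-- numbers −xᵢ are the n−1 roots of (1 + Y)ⁿ − Yⁿ = n Yⁿ⁻¹ + C(n,2) Yⁿ⁻² + ⋯ + C(n,n),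
-- so n eₖ = C(n, k+1) by Vieta.
module Submission where

open import Defs
open import Algebra.Apartness.Bundles using (HeytingCommutativeRing; HeytingField)
open import Algebra.Bundles using (CommutativeRing)
import Algebra.Properties.CommutativeMonoid.Mult as AdditiveMult
import Algebra.Properties.CommutativeSemiring.Exp as CommutativeExp
import Algebra.Properties.Ring as RingProperties
import Algebra.Properties.Semiring.Exp as Exp
import Algebra.Properties.Semiring.Mult as Mult
import Algebra.Solver.Ring.NaturalCoefficients.Default as NaturalSolver
open import Data.Empty using (⊥-elim)
open import Data.Fin.Base as Fin using (Fin; toℕ)
open import Data.Fin.Properties using (toℕ<n)
open import Data.Integer.Base as ℤ using (ℤ; +_; -[1+_]; _⊖_; 1ℤ)
import Data.Integer.Properties as ℤ
import Data.Integer.Tactic.RingSolver as ℤ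
open import Data.List.Base
  using (List; []; _∷_; _∷ʳ_; [_]; _++_; map; replicate; length; zipWith; upTo; allFin)
open import Data.List.Membership.Propositional using (_∈_; find; lose)
open import Data.List.Membership.Propositional.Properties
  using (∈-map⁺; ∈-map⁻; ∈-++⁺ˡ; ∈-++⁺ʳ; ∈-++⁻; ∈-∃++; ∈-concatMap⁺; ∈-concatMap⁻;
         ∈-deduplicate⁺; ∈-deduplicate⁻)
open import Data.List.Membership.Propositional.Properties.WithK using (unique∧set⇒bag)
open import Data.List.Properties
  using (∷-injectiveʳ; ≡-dec; upTo-∷ʳ; length-map; length-tabulate)
open import Data.List.Relation.Binary.BagAndSetEquality using (∼bag⇒↭)
open import Data.List.Relation.Binary.Permutation.Propositional
  using (_↭_; refl; prep; swap; trans; ↭-refl; ↭-sym; ↭-trans; ↭-prep; ↭-swap)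
open import Data.List.Relation.Binary.Permutation.Propositional.Properties
  using (shift; drop-∷; drop-mid; ∈-resp-↭; ↭-empty-inv; ¬x∷xs↭[])
open import Data.List.Relation.Unary.All as All using (All; []; _∷_)
import Data.List.Relation.Unary.All.Properties as All
open import Data.List.Relation.Unary.AllPairs using (AllPairs; []; _∷_)
import Data.List.Relation.Unary.AllPairs.Properties as AllPairs
open import Data.List.Relation.Unary.Any using (here; there)
open import Data.List.Relation.Unary.Unique.Propositional using (Unique)
import Data.List.Relation.Unary.Unique.Propositional.Properties as Unique
open import Data.Nat.Base as ℕ using (ℕ; zero; suc; _∸_; _<_; _≤_)
open import Data.Nat.Combinatorics
  using (_C_; nC1≡n; nCk+nC[k+1]≡[n+1]C[k+1]; k>n⇒nCk≡0; nCn≡1; nCk≡nC[n∸k])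
import Data.Nat.Properties as ℕ
open import Data.List.Relation.Unary.Unique.DecPropositional.Properties (≡-dec ℕ._≟_)
  using (deduplicate-!)
open import Data.Product.Base using (_,_; proj₁; proj₂; ∃-syntax) renaming (_×_ to _∧_)
open import Data.Sum.Base using (_⊎_; inj₁; inj₂)
open import Function.Bundles using (mk⇔)
open import Relation.Binary.PropositionalEquality as ≡ using (_≡_; _≢_; refl)
open import Relation.Nullary using (yes; no)

-- The coefficient of m_(2ᵃ,1ᵇ) in eₚ e_q counts pairs of sets of sizes p and q with a common
-- elements: the b = p + q - 2a elements in exactly one of them can be split in C(b, p - a) ways.
-- The index of summation in the theorem is j = p - a, the number of elements only in the first set,
-- so q - p + j elements lie only in the second. When q < p the sum also runs over j for which that
-- number is negative. Such summands vanish, but for two different reasons: b is negative, or 0 ≤ b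
-- < j. Two obstacles shape the rest. `𝒴` deduplicates a list of permutations, which has no
-- convenient recursion, so it is traded for `words`, generated letter by letter. And equality in a
-- Heyting field need not be decidable: splitting one root off a polynomial keeps the other roots
-- only if their differences from it can be cancelled. Vieta therefore asks for pairwise apart xᵢ,
-- and explicit inverses of xᵢ - xⱼ supply this.

-- Rearrangements of twos and ones

module _ {a} {A : Set a} where

  ∈-insertions⁺ : ∀ {x : A} ys {zs} → ys ++ x ∷ zs ∈ insertions x (ys ++ zs)
  ∈-insertions⁺ []       {[]}    = here refl
  ∈-insertions⁺ []       {_ ∷ _} = here refl
  ∈-insertions⁺ (y ∷ ys)         = there (∈-map⁺ (y ∷_) (∈-insertions⁺ ys))

  ∈-insertions⁻ : ∀ {x : A} {w} ys → w ∈ insertions x ys → w ↭ x ∷ ys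
  ∈-insertions⁻ []       (here refl) = ↭-refl
  ∈-insertions⁻ (y ∷ ys) (here refl) = ↭-refl
  ∈-insertions⁻ (y ∷ ys) (there w∈)
    with _ , v∈ , refl ← ∈-map⁻ (y ∷_) w∈ =
    ↭-trans (↭-prep y (∈-insertions⁻ ys v∈)) (↭-swap y _ ↭-refl)

  ∈-permutations⁺ : ∀ {w : List A} xs → w ↭ xs → w ∈ permutations xs
  ∈-permutations⁺ []       w↭ with refl ← ↭-empty-inv w↭ = here refl
  ∈-permutations⁺ (x ∷ xs) w↭
    with ys , zs , refl ← ∈-∃++ (∈-resp-↭ (↭-sym w↭) (here refl)) =
    ∈-concatMap⁺ (insertions x)
      (lose (∈-permutations⁺ xs (drop-mid ys [] w↭)) (∈-insertions⁺ ys))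

  ∈-permutations⁻ : ∀ {w : List A} xs → w ∈ permutations xs → w ↭ xs
  ∈-permutations⁻ []       (here refl) = ↭-refl
  ∈-permutations⁻ (x ∷ xs) w∈
    with v , v∈ , w∈ins ← find (∈-concatMap⁻ (insertions x) {xs = permutations xs} w∈) =
    ↭-trans (∈-insertions⁻ v w∈ins) (↭-prep x (∈-permutations⁻ xs v∈))

2ᵃ1ᵇ : ℕ → ℕ → List ℕ
2ᵃ1ᵇ a b = replicate a 2 ++ replicate b 1

-- Duplicate-free stand-in for `distinctRearrangements (2ᵃ1ᵇ a b)`. Branching on the first letter is
-- what lets `∑-words` match it with the recursion of `monomial`.
words : ℕ → ℕ → List (List ℕ)
words zero    zero    = [ [] ]
words zero    (suc b) = map (1 ∷_) (words zero b)
words (suc a) zero    = map (2 ∷_) (words a zero)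
words (suc a) (suc b) =
  map (2 ∷_) (words a (suc b)) ++ map (1 ∷_) (words (suc a) b)

words-unique : ∀ a b → Unique (words a b)
words-unique zero    zero    = [] ∷ []
words-unique zero    (suc b) = Unique.map⁺ ∷-injectiveʳ (words-unique zero b)
words-unique (suc a) zero    = Unique.map⁺ ∷-injectiveʳ (words-unique a zero)
words-unique (suc a) (suc b) =
  Unique.++⁺ (Unique.map⁺ ∷-injectiveʳ (words-unique a (suc b)))
             (Unique.map⁺ ∷-injectiveʳ (words-unique (suc a) b))
             λ { (v∈₂ , v∈₁) → disjoint v∈₂ v∈₁ }
  where
  disjoint : ∀ {v xss yss} → v ∈ map (2 ∷_) xss → v ∈ map (1 ∷_) yss → _
  disjoint v∈₂ v∈₁
    with _ , _ , refl ← ∈-map⁻ (2 ∷_) v∈₂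
    with _ , _ , ()   ← ∈-map⁻ (1 ∷_) v∈₁

2∷words⊆ : ∀ a b {w} → w ∈ words a b → 2 ∷ w ∈ words (suc a) b
2∷words⊆ a zero    w∈ = ∈-map⁺ (2 ∷_) w∈
2∷words⊆ a (suc b) w∈ = ∈-++⁺ˡ (∈-map⁺ (2 ∷_) w∈)

1∷words⊆ : ∀ a b {w} → w ∈ words a b → 1 ∷ w ∈ words a (suc b)
1∷words⊆ zero    b w∈ = ∈-map⁺ (1 ∷_) w∈
1∷words⊆ (suc a) b w∈ = ∈-++⁺ʳ (map (2 ∷_) (words a (suc b))) (∈-map⁺ (1 ∷_) w∈)

∷-shift : ∀ a b {w} → w ↭ 2ᵃ1ᵇ a b → 1 ∷ w ↭ 2ᵃ1ᵇ a (suc b)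
∷-shift a b w↭ = ↭-trans (↭-prep 1 w↭) (↭-sym (shift 1 (replicate a 2) (replicate b 1)))

∈-words⁻ : ∀ a b {w} → w ∈ words a b → w ↭ 2ᵃ1ᵇ a b
∈-words⁻ zero zero (here refl) = ↭-refl
∈-words⁻ zero (suc b) w∈
  with _ , v∈ , refl ← ∈-map⁻ (1 ∷_) w∈ = ↭-prep 1 (∈-words⁻ zero b v∈)
∈-words⁻ (suc a) zero w∈
  with _ , v∈ , refl ← ∈-map⁻ (2 ∷_) w∈ = ↭-prep 2 (∈-words⁻ a zero v∈)
∈-words⁻ (suc a) (suc b) w∈ with ∈-++⁻ (map (2 ∷_) (words a (suc b))) w∈
... | inj₁ w∈₂ with _ , v∈ , refl ← ∈-map⁻ (2 ∷_) w∈₂ = ↭-prep 2 (∈-words⁻ a (suc b) v∈)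
... | inj₂ w∈₁ with _ , v∈ , refl ← ∈-map⁻ (1 ∷_) w∈₁ = ∷-shift (suc a) b (∈-words⁻ (suc a) b v∈)

∈-replicate⁻ : ∀ {a} {A : Set a} n {x y : A} → y ∈ replicate n x →
               (y ≡ x) ∧ (∃[ k ] n ≡ suc k)
∈-replicate⁻ (suc n) (here refl) = refl , n , refl
∈-replicate⁻ (suc n) (there y∈) with refl , _ ← ∈-replicate⁻ n y∈ = refl , n , refl

-- The head of the word lies among the twos or among the ones, which fixes its value and makes the
-- corresponding count a successor. Cancelling it on both sides leaves a shorter instance.
∈-words⁺ : ∀ a b w → w ↭ 2ᵃ1ᵇ a b → w ∈ words a b
∈-words⁺ zero    zero    []      w↭ = here refl
∈-words⁺ zero    (suc b) []      w↭ = ⊥-elim (¬x∷xs↭[] (↭-sym w↭))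
∈-words⁺ (suc a) b       []      w↭ = ⊥-elim (¬x∷xs↭[] (↭-sym w↭))
∈-words⁺ a       b       (y ∷ w) w↭
  with ∈-++⁻ (replicate a 2) (∈-resp-↭ w↭ (here refl))
... | inj₁ y∈ with refl , a′ , refl ← ∈-replicate⁻ a y∈ =
  2∷words⊆ a′ b (∈-words⁺ a′ b w (drop-∷ w↭))
... | inj₂ y∈ with refl , b′ , refl ← ∈-replicate⁻ b y∈ =
  1∷words⊆ a b′ (∈-words⁺ a b′ w (drop-mid [] (replicate a 2) w↭))

-- Duplicate-free lists with the same members are permutations of each other, so the order that
-- deduplication leaves behind never has to be analysed.
distinctRearrangements↭words : ∀ a b → distinctRearrangements (2ᵃ1ᵇ a b) ↭ words a b
distinctRearrangements↭words a b =
  ∼bag⇒↭ (unique∧set⇒bag (deduplicate-! (permutations s)) (words-unique a b)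
    (mk⇔ (λ w∈ → ∈-words⁺ a b _ (∈-permutations⁻ s (∈-deduplicate⁻ _≟_ (permutations s) w∈)))
         (λ w∈ → ∈-deduplicate⁺ _≟_ (∈-permutations⁺ s (∈-words⁻ a b w∈)))))
  where
  s = 2ᵃ1ᵇ a b
  _≟_ = ≡-dec ℕ._≟_

-- Arithmetic of the indices

nC0≡1 : ∀ n → n C 0 ≡ 1
nC0≡1 n = ≡.trans (nCk≡nC[n∸k] {0} {n} ℕ.z≤n) (nCn≡1 n)

m⊖n+n≡m : ∀ m n → (m ⊖ n) ℤ.+ + n ≡ + m
m⊖n+n≡m m n = ≡.trans (ℤ.distribˡ-⊖-+-pos n m n)
  (≡.trans (ℤ.≤-⊖ (ℕ.m≤n+m n m)) (≡.cong +_ (ℕ.m+n∸n≡m m n)))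

upperIndex : ∀ m p j → j ≤ p →
  + suc (p ℕ.+ m) ℤ.- + m ℤ.- + j ℤ.- 1ℤ ≡ + (p ∸ j)
upperIndex m p j j≤p =
  ≡.trans (regroup (+ p) (+ m) (+ j)) (≡.trans (ℤ.m-n≡m⊖n p j) (ℤ.⊖-≥ j≤p))
  where
  regroup : ∀ p m j → 1ℤ ℤ.+ (p ℤ.+ m) ℤ.- m ℤ.- j ℤ.- 1ℤ ≡ p ℤ.- j
  regroup = ℤ.solve-∀

-- The hypothesis says m - ℓ = q - p. The two copies of j stay apart because `(q ⊖ p) ℤ.+ + j` and
-- `j` are the sizes of the two set differences.
lowerIndex : ∀ m ℓ p q j → p ℕ.+ m ≡ q ℕ.+ ℓ →
  + m ℤ.- + ℓ ℤ.+ + (2 ℕ.* j) ≡ (q ⊖ p) ℤ.+ + j ℤ.+ + j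
lowerIndex m ℓ p q j eq = begin
  + m ℤ.- + ℓ ℤ.+ + (2 ℕ.* j)
    ≡⟨ regroup (+ p) (+ m) (+ ℓ) (+ j) ⟩
  + (p ℕ.+ m) ℤ.- + ℓ ℤ.- + p ℤ.+ + j ℤ.+ + j
    ≡⟨ ≡.cong (λ s → + s ℤ.- + ℓ ℤ.- + p ℤ.+ + j ℤ.+ + j) eq ⟩
  + (q ℕ.+ ℓ) ℤ.- + ℓ ℤ.- + p ℤ.+ + j ℤ.+ + j
    ≡⟨ cancel (+ p) (+ q) (+ ℓ) (+ j) ⟩
  + q ℤ.- + p ℤ.+ + j ℤ.+ + j
    ≡⟨ ≡.cong (λ d → d ℤ.+ + j ℤ.+ + j) (ℤ.m-n≡m⊖n q p) ⟩
  (q ⊖ p) ℤ.+ + j ℤ.+ + j ∎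
  where
  open ≡.≡-Reasoning

  regroup : ∀ p m ℓ j →
    m ℤ.- ℓ ℤ.+ (j ℤ.+ (j ℤ.+ + 0)) ≡ (p ℤ.+ m) ℤ.- ℓ ℤ.- p ℤ.+ j ℤ.+ j
  regroup = ℤ.solve-∀

  cancel : ∀ p q ℓ j →
    (q ℤ.+ ℓ) ℤ.- ℓ ℤ.- p ℤ.+ j ℤ.+ j ≡ q ℤ.- p ℤ.+ j ℤ.+ j
  cancel = ℤ.solve-∀

module _ {c ℓ₁ ℓ₂} (K : HeytingField c ℓ₁ ℓ₂) where

  open HeytingField K
    using (Carrier; _≈_; _+_; _*_; 0#; 1#; -_; _-_; _#_; heytingCommutativeRing;
           #-sym; #⇒invertible; invertible⇒#)
  open CommutativeRing (HeytingCommutativeRing.commutativeRing heytingCommutativeRing)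
    hiding (Carrier; _≈_; _+_; _*_; 0#; 1#; -_; _-_; zero)
    renaming (reflexive to ≈-reflexive; refl to ≈-refl; trans to ≈-trans)
  open import Relation.Binary.Reasoning.Setoid setoid
  open FieldDefs K
  open NaturalSolver commutativeSemiring using (solve; _:=_; _:+_; _:*_; con)
  open Mult semiring hiding (_×_)
  open Exp semiring hiding (_^_)
  open CommutativeExp commutativeSemiring using (^-distrib-*)
  open AdditiveMult +-commutativeMonoid using (×-distrib-+)
  open RingProperties ring
    using (-‿distribˡ-*; +-identityʳ-unique; -0#≈0#; x[y-z]≈xy-xz; [y-z]x≈yx-zx)

  -- Shifted sequences and finite sums

  ×-zeroʳ : ∀ n → n × 0# ≈ 0#
  ×-zeroʳ zero    = ≈-refl
  ×-zeroʳ (suc n) = ≈-trans (+-identityˡ _) (×-zeroʳ n)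

  -- f(n − 1), with f(−1) read as 0.
  pre : (ℕ → Carrier) → ℕ → Carrier
  pre f zero    = 0#
  pre f (suc n) = f n

  pre-cong : ∀ {f g} → (∀ n → f n ≈ g n) → ∀ n → pre f n ≈ pre g n
  pre-cong f≈g zero    = ≈-refl
  pre-cong f≈g (suc n) = f≈g n

  module _ {a} {A : Set a} where

    ∑-cong : ∀ (xs : List A) {f g} → (∀ x → f x ≈ g x) → ∑ xs f ≈ ∑ xs g
    ∑-cong []       f≈g = ≈-refl
    ∑-cong (x ∷ xs) f≈g = +-cong (f≈g x) (∑-cong xs f≈g)

    ∑-++ : ∀ (xs ys : List A) f → ∑ (xs ++ ys) f ≈ ∑ xs f + ∑ ys f
    ∑-++ []       ys f = sym (+-identityˡ _)
    ∑-++ (x ∷ xs) ys f = ≈-trans (+-congˡ (∑-++ xs ys f)) (sym (+-assoc _ _ _))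

    ∑-map : ∀ {b} {B : Set b} (g : B → A) xs f → ∑ (map g xs) f ≡ ∑ xs (λ x → f (g x))
    ∑-map g []       f = ≡.refl
    ∑-map g (x ∷ xs) f = ≡.cong₂ _+_ ≡.refl (∑-map g xs f)

    ∑-+ : ∀ (xs : List A) f g → ∑ xs (λ x → f x + g x) ≈ ∑ xs f + ∑ xs g
    ∑-+ []       f g = sym (+-identityˡ 0#)
    ∑-+ (x ∷ xs) f g = ≈-trans (+-congˡ (∑-+ xs f g))
      (solve 4 (λ a b c d → (a :+ b) :+ (c :+ d) := (a :+ c) :+ (b :+ d)) ≈-refl _ _ _ _)

    ∑-* : ∀ (xs : List A) k f → ∑ xs (λ x → k * f x) ≈ k * ∑ xs f
    ∑-* []       k f = sym (zeroʳ k)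
    ∑-* (x ∷ xs) k f = ≈-trans (+-congˡ (∑-* xs k f)) (sym (distribˡ k _ _))

    ∑-0 : ∀ (xs : List A) → ∑ xs (λ _ → 0#) ≈ 0#
    ∑-0 []       = ≈-refl
    ∑-0 (x ∷ xs) = ≈-trans (+-identityˡ _) (∑-0 xs)

    ∑-↭ : ∀ {xs ys : List A} f → xs ↭ ys → ∑ xs f ≈ ∑ ys f
    ∑-↭ f refl         = ≈-refl
    ∑-↭ f (prep x p)   = +-congˡ (∑-↭ f p)
    ∑-↭ f (swap x y p) = ≈-trans (+-congˡ (+-congˡ (∑-↭ f p)))
      (solve 3 (λ a b c → a :+ (b :+ c) := b :+ (a :+ c)) ≈-refl _ _ _)
    ∑-↭ f (trans p q)  = ≈-trans (∑-↭ f p) (∑-↭ f q)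

  ∑-upTo-suc : ∀ n f → ∑ (upTo (suc n)) f ≈ ∑ (upTo n) f + f n
  ∑-upTo-suc n f = begin
    ∑ (upTo (suc n)) f       ≡⟨ ≡.cong (λ is → ∑ is f) (upTo-∷ʳ n) ⟨
    ∑ (upTo n ∷ʳ n) f        ≈⟨ ∑-++ (upTo n) [ n ] f ⟩
    ∑ (upTo n) f + (f n + 0#) ≈⟨ +-congˡ (+-identityʳ _) ⟩
    ∑ (upTo n) f + f n       ∎

  ∑-upTo-cong : ∀ n {f g} → (∀ i → i < n → f i ≈ g i) → ∑ (upTo n) f ≈ ∑ (upTo n) g
  ∑-upTo-cong zero    f≈g = ≈-refl
  ∑-upTo-cong (suc n) {f} {g} f≈g = begin
    ∑ (upTo (suc n)) f  ≈⟨ ∑-upTo-suc n f ⟩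
    ∑ (upTo n) f + f n
      ≈⟨ +-cong (∑-upTo-cong n (λ i i<n → f≈g i (ℕ.m<n⇒m<1+n i<n))) (f≈g n ℕ.≤-refl) ⟩
    ∑ (upTo n) g + g n  ≈⟨ ∑-upTo-suc n g ⟨
    ∑ (upTo (suc n)) g  ∎

  -- Monomial symmetric polynomials as sums over words

  -- The sum of x₁^s₁ ⋯ xₖ^sₖ over all sublists (x₁, …, xₖ).
  quasiMonomial : List ℕ → List Carrier → Carrier
  quasiMonomial []      _        = 1#
  quasiMonomial (s ∷ w) []       = 0#
  quasiMonomial (s ∷ w) (x ∷ xs) = x ^ s * quasiMonomial w xs + quasiMonomial (s ∷ w) xs

  quasiMonomial-combinations : ∀ {a} {A : Set a} (f : A → Carrier) w xs →
    (∑[ is ∈ combinations (length w) xs ] ∏ (zipWith (λ i s → f i ^ s) is w))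
      ≈ quasiMonomial w (map f xs)
  quasiMonomial-combinations f []      xs       = +-identityʳ 1#
  quasiMonomial-combinations f (s ∷ w) []       = ≈-refl
  quasiMonomial-combinations f (s ∷ w) (x ∷ xs) = begin
    ∑ (map (x ∷_) C₁ ++ C₂) g           ≈⟨ ∑-++ (map (x ∷_) C₁) C₂ g ⟩
    ∑ (map (x ∷_) C₁) g + ∑ C₂ g        ≡⟨ ≡.cong₂ _+_ (∑-map (x ∷_) C₁ g) ≡.refl ⟩
    ∑ C₁ (λ is → f x ^ s * h is) + ∑ C₂ g
      ≈⟨ +-cong (≈-trans (∑-* C₁ (f x ^ s) h) (*-congˡ (quasiMonomial-combinations f w xs)))
                (quasiMonomial-combinations f (s ∷ w) xs) ⟩
    quasiMonomial (s ∷ w) (f x ∷ map f xs) ∎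
    where
    C₁ = combinations (length w) xs
    C₂ = combinations (suc (length w)) xs
    g = λ is → ∏ (zipWith (λ i s → f i ^ s) is (s ∷ w))
    h = λ is → ∏ (zipWith (λ i s → f i ^ s) is w)

  -- m_(2ᵃ,1ᵇ)
  monomial : ℕ → ℕ → List Carrier → Carrier
  monomial a       b       (x ∷ xs) =
    monomial a b xs
      + (x ^ 2 * pre (λ a → monomial a b xs) a + x ^ 1 * pre (λ b → monomial a b xs) b)
  monomial zero    zero    []       = 1#
  monomial zero    (suc b) []       = 0#
  monomial (suc a) b       []       = 0#

  monomial-00 : ∀ xs → monomial 0 0 xs ≈ 1#
  monomial-00 []       = ≈-refl
  monomial-00 (x ∷ xs) = begin
    monomial 0 0 xs + (x ^ 2 * 0# + x ^ 1 * 0#)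
      ≈⟨ +-cong (monomial-00 xs) (+-cong (zeroʳ _) (zeroʳ _)) ⟩
    1# + (0# + 0#) ≈⟨ +-congˡ (+-identityʳ 0#) ⟩
    1# + 0#        ≈⟨ +-identityʳ 1# ⟩
    1#             ∎

  ∑-∷-quasiMonomial-[] : ∀ s ws → ∑ (map (s ∷_) ws) (λ w → quasiMonomial w []) ≈ 0#
  ∑-∷-quasiMonomial-[] s ws =
    ≈-trans (≈-reflexive (∑-map (s ∷_) ws _)) (∑-0 ws)

  ∑-∷-quasiMonomial : ∀ s ws x xs →
    ∑ (map (s ∷_) ws) (λ w → quasiMonomial w (x ∷ xs))
      ≈ x ^ s * ∑ ws (λ w → quasiMonomial w xs)
        + ∑ (map (s ∷_) ws) (λ w → quasiMonomial w xs)
  ∑-∷-quasiMonomial s ws x xs = begin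
    ∑ (map (s ∷_) ws) (λ w → quasiMonomial w (x ∷ xs))
      ≡⟨ ∑-map (s ∷_) ws _ ⟩
    ∑ ws (λ w → x ^ s * quasiMonomial w xs + quasiMonomial (s ∷ w) xs)
      ≈⟨ ∑-+ ws _ _ ⟩
    ∑ ws (λ w → x ^ s * quasiMonomial w xs) + ∑ ws (λ w → quasiMonomial (s ∷ w) xs)
      ≈⟨ +-cong (∑-* ws _ _) (≈-reflexive (≡.sym (∑-map (s ∷_) ws _))) ⟩
    x ^ s * ∑ ws (λ w → quasiMonomial w xs)
      + ∑ (map (s ∷_) ws) (λ w → quasiMonomial w xs) ∎

  -- Either `x` is skipped, or it takes the first letter of the word as its exponent. Grouping the
  -- words by that letter turns these cases into the three summands of `monomial`.
  ∑-words : ∀ a b xs → (∑[ w ∈ words a b ] quasiMonomial w xs) ≈ monomial a b xs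
  ∑-words zero    zero    xs = ≈-trans (+-identityʳ 1#) (sym (monomial-00 xs))
  ∑-words zero    (suc b) [] = ∑-∷-quasiMonomial-[] 1 (words 0 b)
  ∑-words (suc a) zero    [] = ∑-∷-quasiMonomial-[] 2 (words a 0)
  ∑-words (suc a) (suc b) [] = begin
    ∑ (words (suc a) (suc b)) (λ w → quasiMonomial w [])
      ≈⟨ ∑-++ (map (2 ∷_) (words a (suc b))) _ _ ⟩
    _ ≈⟨ +-cong (∑-∷-quasiMonomial-[] 2 (words a (suc b)))
                (∑-∷-quasiMonomial-[] 1 (words (suc a) b)) ⟩
    0# + 0# ≈⟨ +-identityʳ 0# ⟩
    0# ∎
  ∑-words zero (suc b) (x ∷ xs) = begin
    ∑ (words 0 (suc b)) (λ w → quasiMonomial w (x ∷ xs))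
      ≈⟨ ∑-∷-quasiMonomial 1 (words 0 b) x xs ⟩
    _ ≈⟨ +-cong (*-congˡ (∑-words 0 b xs)) (∑-words 0 (suc b) xs) ⟩
    x ^ 1 * monomial 0 b xs + monomial 0 (suc b) xs
      ≈⟨ solve 4 (λ y z m n → y :* m :+ n := n :+ (z :* con 0 :+ y :* m)) ≈-refl _ (x ^ 2) _ _ ⟩
    monomial 0 (suc b) (x ∷ xs) ∎
  ∑-words (suc a) zero (x ∷ xs) = begin
    ∑ (words (suc a) 0) (λ w → quasiMonomial w (x ∷ xs))
      ≈⟨ ∑-∷-quasiMonomial 2 (words a 0) x xs ⟩
    _ ≈⟨ +-cong (*-congˡ (∑-words a 0 xs)) (∑-words (suc a) 0 xs) ⟩
    x ^ 2 * monomial a 0 xs + monomial (suc a) 0 xs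
      ≈⟨ solve 4 (λ y z m n → z :* m :+ n := n :+ (z :* m :+ y :* con 0)) ≈-refl (x ^ 1) _ _ _ ⟩
    monomial (suc a) 0 (x ∷ xs) ∎
  ∑-words (suc a) (suc b) (x ∷ xs) = begin
    ∑ (words (suc a) (suc b)) (λ w → quasiMonomial w (x ∷ xs))
      ≈⟨ ∑-++ (map (2 ∷_) W₂) _ _ ⟩
    _ ≈⟨ +-cong (∑-∷-quasiMonomial 2 W₂ x xs) (∑-∷-quasiMonomial 1 W₁ x xs) ⟩
    (x ^ 2 * ∑ W₂ q + ∑ (map (2 ∷_) W₂) q) + (x ^ 1 * ∑ W₁ q + ∑ (map (1 ∷_) W₁) q)
      ≈⟨ solve 4 (λ k l m n → (k :+ l) :+ (m :+ n) := (l :+ n) :+ (k :+ m)) ≈-refl _ _ _ _ ⟩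
    (∑ (map (2 ∷_) W₂) q + ∑ (map (1 ∷_) W₁) q) + (x ^ 2 * ∑ W₂ q + x ^ 1 * ∑ W₁ q)
      ≈⟨ +-congʳ (∑-++ (map (2 ∷_) W₂) _ _) ⟨
    ∑ (words (suc a) (suc b)) q + (x ^ 2 * ∑ W₂ q + x ^ 1 * ∑ W₁ q)
      ≈⟨ +-cong (∑-words (suc a) (suc b) xs)
                (+-cong (*-congˡ (∑-words a (suc b) xs)) (*-congˡ (∑-words (suc a) b xs))) ⟩
    monomial (suc a) (suc b) (x ∷ xs) ∎
    where
    W₂ = words a (suc b)
    W₁ = words (suc a) b
    q = λ w → quasiMonomial w xs

  -- The product of two elementary symmetric polynomials

  elementary : ℕ → List Carrier → Carrier
  elementary zero    _        = 1#
  elementary (suc k) []       = 0#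
  elementary (suc k) (x ∷ xs) = elementary (suc k) xs + x * elementary k xs

  -- F(a, p, q) + F(a+1, p−1, q−1) + ⋯, as long as both p − t and q − t are natural.
  diagonalSum : (ℕ → ℕ → ℕ → Carrier) → ℕ → ℕ → ℕ → Carrier
  diagonalSum F a zero    q       = F a zero q
  diagonalSum F a (suc p) zero    = F a (suc p) zero
  diagonalSum F a (suc p) (suc q) = F a (suc p) (suc q) + diagonalSum F (suc a) p q

  diagonalSum-cong : ∀ {F G} → (∀ a i k → F a i k ≈ G a i k) →
                     ∀ a p q → diagonalSum F a p q ≈ diagonalSum G a p q
  diagonalSum-cong F≈G a zero    q       = F≈G a zero q
  diagonalSum-cong F≈G a (suc p) zero    = F≈G a (suc p) zero
  diagonalSum-cong F≈G a (suc p) (suc q) =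
    +-cong (F≈G a (suc p) (suc q)) (diagonalSum-cong F≈G (suc a) p q)

  diagonalSum-+ : ∀ F G a p q →
    diagonalSum (λ a i k → F a i k + G a i k) a p q ≈ diagonalSum F a p q + diagonalSum G a p q
  diagonalSum-+ F G a zero    q       = ≈-refl
  diagonalSum-+ F G a (suc p) zero    = ≈-refl
  diagonalSum-+ F G a (suc p) (suc q) = ≈-trans (+-congˡ (diagonalSum-+ F G (suc a) p q))
    (solve 4 (λ a b c d → (a :+ b) :+ (c :+ d) := (a :+ c) :+ (b :+ d)) ≈-refl _ _ _ _)

  diagonalSum-* : ∀ x F a p q →
    diagonalSum (λ a i k → x * F a i k) a p q ≈ x * diagonalSum F a p q
  diagonalSum-* x F a zero    q       = ≈-refl
  diagonalSum-* x F a (suc p) zero    = ≈-refl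
  diagonalSum-* x F a (suc p) (suc q) =
    ≈-trans (+-congˡ (diagonalSum-* x F (suc a) p q)) (sym (distribˡ x _ _))

  diagonalSum-pre₁-suc : ∀ F a p q →
    diagonalSum (λ a i k → pre (λ a → F a i k) a) (suc a) p q ≈ diagonalSum F a p q
  diagonalSum-pre₁-suc F a zero    q       = ≈-refl
  diagonalSum-pre₁-suc F a (suc p) zero    = ≈-refl
  diagonalSum-pre₁-suc F a (suc p) (suc q) = +-congˡ (diagonalSum-pre₁-suc F (suc a) p q)

  -- The first summand has `a` equal to 0 and is killed by the shift; what remains is the diagonal
  -- that starts one step further down in both p and q.
  diagonalSum-pre₁-zero : ∀ F p q →
    diagonalSum (λ a i k → pre (λ a → F a i k) a) 0 p q
      ≈ pre (λ p → pre (λ q → diagonalSum F 0 p q) q) p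
  diagonalSum-pre₁-zero F zero    q       = ≈-refl
  diagonalSum-pre₁-zero F (suc p) zero    = ≈-refl
  diagonalSum-pre₁-zero F (suc p) (suc q) =
    ≈-trans (+-identityˡ _) (diagonalSum-pre₁-suc F 0 p q)

  diagonalSum-zeroʳ : ∀ F a p → diagonalSum F a p 0 ≈ F a p 0
  diagonalSum-zeroʳ F a zero    = ≈-refl
  diagonalSum-zeroʳ F a (suc p) = ≈-refl

  -- If p ≤ q, the diagonal from p - 1 is one summand shorter, and the surplus summand on the left
  -- is the one with i = 0, where `pre` gives 0. If p > q, both have the same length.
  diagonalSum-pre₂ : ∀ F a p q →
    diagonalSum (λ a i k → pre (λ i → F a i k) i) a p q ≈ pre (λ p → diagonalSum F a p q) p
  diagonalSum-pre₂ F a zero          q       = ≈-refl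
  diagonalSum-pre₂ F a (suc p)       zero    = sym (diagonalSum-zeroʳ F a p)
  diagonalSum-pre₂ F a (suc zero)    (suc q) =
    ≈-trans (+-congˡ (diagonalSum-pre₂ F (suc a) zero q)) (+-identityʳ _)
  diagonalSum-pre₂ F a (suc (suc p)) (suc q) = +-congˡ (diagonalSum-pre₂ F (suc a) (suc p) q)

  diagonalSum-pre₃ : ∀ F a p q →
    diagonalSum (λ a i k → pre (λ k → F a i k) k) a p q ≈ pre (λ q → diagonalSum F a p q) q
  diagonalSum-pre₃ F a zero    zero          = ≈-refl
  diagonalSum-pre₃ F a zero    (suc q)       = ≈-refl
  diagonalSum-pre₃ F a (suc p) zero          = ≈-refl
  diagonalSum-pre₃ F a (suc p) (suc zero)    =
    ≈-trans (+-congˡ (diagonalSum-pre₃ F (suc a) p zero)) (+-identityʳ _)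
  diagonalSum-pre₃ F a (suc p) (suc (suc q)) = +-congˡ (diagonalSum-pre₃ F (suc a) p (suc q))

  -- The contribution to eᵢ₊ₐ eₖ₊ₐ of pairs of sets with intersection of size a.
  productTerm : List Carrier → ℕ → ℕ → ℕ → Carrier
  productTerm xs a i k = ((i ℕ.+ k) C i) × monomial a (i ℕ.+ k) xs

  -- The new element is in neither set, in both, only in the first or only in the second. The last
  -- two cases share the factor `x ^ 1` and are separated by Pascal's rule.
  productTerm-∷ : ∀ x xs a i k →
    productTerm (x ∷ xs) a i k
      ≈ productTerm xs a i k
        + (x ^ 2 * pre (λ a → productTerm xs a i k) a
           + x ^ 1 * (pre (λ i → productTerm xs a i k) i + pre (λ k → productTerm xs a i k) k))
  productTerm-∷ x xs a i k = begin
    n × (M + (x ^ 2 * U + x ^ 1 * V))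
      ≈⟨ ×-distrib-+ M _ n ⟩
    n × M + n × (x ^ 2 * U + x ^ 1 * V)
      ≈⟨ +-congˡ (×-distrib-+ _ _ n) ⟩
    n × M + (n × (x ^ 2 * U) + n × (x ^ 1 * V))
      ≈⟨ +-congˡ (+-cong (×-comm-* n (x ^ 2) U) (×-comm-* n (x ^ 1) V)) ⟨
    n × M + (x ^ 2 * n × U + x ^ 1 * n × V)
      ≈⟨ +-congˡ (+-cong (*-congˡ (pre₁ a)) (*-congˡ (pre₂₃ i k))) ⟩
    _ ∎
    where
    n = (i ℕ.+ k) C i
    M = monomial a (i ℕ.+ k) xs
    U = pre (λ a → monomial a (i ℕ.+ k) xs) a
    V = pre (λ b → monomial a b xs) (i ℕ.+ k)

    pre₁ : ∀ a → n × pre (λ a → monomial a (i ℕ.+ k) xs) a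
                   ≈ pre (λ a → productTerm xs a i k) a
    pre₁ zero    = ×-zeroʳ n
    pre₁ (suc a) = ≈-refl

    pre₂₃ : ∀ i k → ((i ℕ.+ k) C i) × pre (λ b → monomial a b xs) (i ℕ.+ k)
              ≈ pre (λ i → productTerm xs a i k) i + pre (λ k → productTerm xs a i k) k
    pre₂₃ zero    zero    = ≈-trans (×-zeroʳ 1) (sym (+-identityʳ 0#))
    -- On the boundary one of the two sets has no element of its own, so only one case remains and
    -- both binomial coefficients are 1.
    pre₂₃ zero    (suc k) =
      ≈-trans (×-congˡ (≡.trans (nC0≡1 (suc k)) (≡.sym (nC0≡1 k)))) (sym (+-identityˡ _))
    pre₂₃ (suc i) zero    = begin
      (suc (i ℕ.+ 0) C suc i) × monomial a (i ℕ.+ 0) xs ≈⟨ ×-congˡ diagonal ⟩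
      productTerm xs a i 0                              ≈⟨ +-identityʳ _ ⟨
      productTerm xs a i 0 + 0#                         ∎
      where
      diagonal : suc (i ℕ.+ 0) C suc i ≡ (i ℕ.+ 0) C i
      diagonal rewrite ℕ.+-identityʳ i = ≡.trans (nCn≡1 (suc i)) (≡.sym (nCn≡1 i))
    pre₂₃ (suc i) (suc k) = begin
      (suc (i ℕ.+ suc k) C suc i) × m (i ℕ.+ suc k)
        ≈⟨ ×-congˡ (≡.sym (nCk+nC[k+1]≡[n+1]C[k+1] (i ℕ.+ suc k) i)) ⟩
      ((i ℕ.+ suc k) C i ℕ.+ (i ℕ.+ suc k) C suc i) × m (i ℕ.+ suc k)
        ≈⟨ ×-homo-+ _ ((i ℕ.+ suc k) C i) _ ⟩
      ((i ℕ.+ suc k) C i) × m (i ℕ.+ suc k) + ((i ℕ.+ suc k) C suc i) × m (i ℕ.+ suc k)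
        ≡⟨ ≡.cong (λ b → ((i ℕ.+ suc k) C i) × m (i ℕ.+ suc k) + (b C suc i) × m b)
                  (ℕ.+-suc i k) ⟩
      productTerm xs a i (suc k) + productTerm xs a (suc i) k ∎
      where m = λ b → monomial a b xs

  -- Without elements, the pair of empty sets is the only one that contributes.
  productTerm-[] : ∀ a i k → a ℕ.+ (i ℕ.+ k) ≢ 0 → productTerm [] a i k ≈ 0#
  productTerm-[] zero    zero    zero    ≢0 = ⊥-elim (≢0 ≡.refl)
  productTerm-[] zero    zero    (suc k) _  = ×-zeroʳ (suc k C 0)
  productTerm-[] zero    (suc i) k       _  = ×-zeroʳ ((suc i ℕ.+ k) C suc i)
  productTerm-[] (suc a) i       k       _  = ×-zeroʳ ((i ℕ.+ k) C i)

  diagonalSum-productTerm-[] : ∀ a p q → a ℕ.+ (p ℕ.+ q) ≢ 0 →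
                               diagonalSum (productTerm []) a p q ≈ 0#
  diagonalSum-productTerm-[] a zero    q       ≢0 = productTerm-[] a zero q ≢0
  diagonalSum-productTerm-[] a (suc p) zero    ≢0 = productTerm-[] a (suc p) zero ≢0
  diagonalSum-productTerm-[] a (suc p) (suc q) ≢0 = begin
    productTerm [] a (suc p) (suc q) + diagonalSum (productTerm []) (suc a) p q
      ≈⟨ +-cong (productTerm-[] a (suc p) (suc q) ≢0)
                (diagonalSum-productTerm-[] (suc a) p q λ ()) ⟩
    0# + 0# ≈⟨ +-identityʳ 0# ⟩
    0# ∎

  elementary-∷ : ∀ x xs k →
    elementary k (x ∷ xs) ≈ elementary k xs + x * pre (λ k → elementary k xs) k
  elementary-∷ x xs zero    = sym (≈-trans (+-congˡ (zeroʳ x)) (+-identityʳ 1#))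
  elementary-∷ x xs (suc k) = ≈-refl

  -- Expanding both factors at `x` gives four products, each a diagonal sum by induction but with p
  -- or q lowered. The lemmas on `pre` carry these shifts inside to the summands, where
  -- `productTerm-∷` reassembles them.
  elementary-* : ∀ xs p q →
    elementary p xs * elementary q xs ≈ diagonalSum (productTerm xs) 0 p q
  elementary-* [] zero    zero    = begin
    1# * 1#                           ≈⟨ *-identityˡ 1# ⟩
    1#                                ≈⟨ +-identityʳ 1# ⟨
    1 × 1#                            ≈⟨ ×-congˡ {x = 1#} (nC0≡1 0) ⟨
    (0 C 0) × 1#                      ∎
  elementary-* [] zero    (suc q) =
    ≈-trans (zeroʳ 1#) (sym (diagonalSum-productTerm-[] 0 0 (suc q) λ ()))
  elementary-* [] (suc p) q =
    ≈-trans (zeroˡ _) (sym (diagonalSum-productTerm-[] 0 (suc p) q λ ()))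
  elementary-* (x ∷ xs) p q = begin
    elementary p (x ∷ xs) * elementary q (x ∷ xs)
      ≈⟨ *-cong (elementary-∷ x xs p) (elementary-∷ x xs q) ⟩
    (e p + x * pre e p) * (e q + x * pre e q)
      ≈⟨ solve 5 (λ x a b c d → (a :+ x :* b) :* (c :+ x :* d)
           := a :* c :+ (x :* (x :* con 1) :* (b :* d) :+ x :* con 1 :* (b :* c :+ a :* d)))
           ≈-refl x (e p) (pre e p) (e q) (pre e q) ⟩
    e p * e q + (x ^ 2 * (pre e p * pre e q) + x ^ 1 * (pre e p * e q + e p * pre e q))
      ≈⟨ +-cong (elementary-* xs p q)
           (+-cong (*-congˡ (≈-trans (shiftBoth p q) (sym (diagonalSum-pre₁-zero G p q))))
             (*-congˡ (+-cong (≈-trans (shiftˡ p q) (sym (diagonalSum-pre₂ G 0 p q)))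
                              (≈-trans (shiftʳ p q) (sym (diagonalSum-pre₃ G 0 p q)))))) ⟩
    D G + (x ^ 2 * D G₁ + x ^ 1 * (D G₂ + D G₃))
      ≈⟨ +-congˡ (+-cong (diagonalSum-* _ G₁ 0 p q)
           (≈-trans (diagonalSum-* _ _ 0 p q) (*-congˡ (diagonalSum-+ G₂ G₃ 0 p q)))) ⟨
    D G + (D (λ a i k → x ^ 2 * G₁ a i k) + D (λ a i k → x ^ 1 * (G₂ a i k + G₃ a i k)))
      ≈⟨ ≈-trans (diagonalSum-+ G _ 0 p q) (+-congˡ (diagonalSum-+ _ _ 0 p q)) ⟨
    D (λ a i k → G a i k + (x ^ 2 * G₁ a i k + x ^ 1 * (G₂ a i k + G₃ a i k)))
      ≈⟨ diagonalSum-cong (productTerm-∷ x xs) 0 p q ⟨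
    D (productTerm (x ∷ xs)) ∎
    where
    e = λ k → elementary k xs
    G = productTerm xs
    D = λ F → diagonalSum F 0 p q
    G₁ = λ a i k → pre (λ a → G a i k) a
    G₂ = λ a i k → pre (λ i → G a i k) i
    G₃ = λ a i k → pre (λ k → G a i k) k

    shiftBoth : ∀ p q → pre e p * pre e q ≈ pre (λ p → pre (λ q → diagonalSum G 0 p q) q) p
    shiftBoth zero    q       = zeroˡ _
    shiftBoth (suc p) zero    = zeroʳ _
    shiftBoth (suc p) (suc q) = elementary-* xs p q

    shiftˡ : ∀ p q → pre e p * e q ≈ pre (λ p → diagonalSum G 0 p q) p
    shiftˡ zero    q = zeroˡ _
    shiftˡ (suc p) q = elementary-* xs p q

    shiftʳ : ∀ p q → e p * pre e q ≈ pre (λ q → diagonalSum G 0 p q) q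
    shiftʳ p zero    = zeroʳ _
    shiftʳ p (suc q) = elementary-* xs p q

  -- The diagonal as a sum over j

  extendByZero : (ℕ → Carrier) → ℤ → Carrier
  extendByZero f (+ k)    = f k
  extendByZero f -[1+ k ] = 0#

  -- The sum runs along the diagonal backwards, its index j being the current value of p, so each
  -- step of the recursion splits off the last summand. If q < p, the summands with j < p - q lie
  -- beyond the end of the diagonal and vanish.
  diagonalSum-∑ : ∀ F a p q →
    (∑[ j ∈ upTo (suc p) ] extendByZero (F (a ℕ.+ (p ∸ j)) j) ((q ⊖ p) ℤ.+ + j))
      ≈ diagonalSum F a p q
  diagonalSum-∑ F a zero q = begin
    extendByZero (F (a ℕ.+ 0) 0) (+ q ℤ.+ + 0) + 0# ≈⟨ +-identityʳ _ ⟩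
    F (a ℕ.+ 0) 0 (q ℕ.+ 0)
      ≡⟨ ≡.cong₂ (λ a q → F a 0 q) (ℕ.+-identityʳ a) (ℕ.+-identityʳ q) ⟩
    F a 0 q ∎
  diagonalSum-∑ F a (suc p) zero = begin
    ∑ (upTo (suc (suc p))) f       ≈⟨ ∑-upTo-suc (suc p) f ⟩
    ∑ (upTo (suc p)) f + f (suc p) ≈⟨ +-cong (∑-upTo-cong (suc p) vanish) (≈-reflexive last) ⟩
    ∑ (upTo (suc p)) (λ _ → 0#) + F a (suc p) 0 ≈⟨ +-congʳ (∑-0 (upTo (suc p))) ⟩
    0# + F a (suc p) 0             ≈⟨ +-identityˡ _ ⟩
    F a (suc p) 0                  ∎
    where
    f = λ j → extendByZero (F (a ℕ.+ (suc p ∸ j)) j) (-[1+ p ] ℤ.+ + j)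

    -- The rewriting exhibits the third index as the negative of a successor, on which
    -- `extendByZero` reduces to 0.
    vanish : ∀ j → j < suc p → f j ≈ 0#
    vanish j (ℕ.s≤s j≤p)
      rewrite ℤ.⊖-< (ℕ.s≤s j≤p) | ℕ.+-∸-assoc 1 j≤p = ≈-refl

    last : f (suc p) ≡ F a (suc p) 0
    last rewrite ℕ.n∸n≡0 p | ℕ.+-identityʳ a | ℤ.n⊖n≡0 (suc p) = ≡.refl
  diagonalSum-∑ F a (suc p) (suc q) = begin
    ∑ (upTo (suc (suc p))) f       ≈⟨ ∑-upTo-suc (suc p) f ⟩
    ∑ (upTo (suc p)) f + f (suc p)
      ≈⟨ +-cong (∑-upTo-cong (suc p) (λ j j<1+p → ≈-reflexive (reindex j j<1+p)))
                (≈-reflexive last) ⟩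
    ∑ (upTo (suc p)) (λ j → extendByZero (F (suc a ℕ.+ (p ∸ j)) j) ((q ⊖ p) ℤ.+ + j))
      + F a (suc p) (suc q)
      ≈⟨ +-congʳ (diagonalSum-∑ F (suc a) p q) ⟩
    diagonalSum F (suc a) p q + F a (suc p) (suc q) ≈⟨ +-comm _ _ ⟩
    diagonalSum F a (suc p) (suc q) ∎
    where
    f = λ j → extendByZero (F (a ℕ.+ (suc p ∸ j)) j) ((suc q ⊖ suc p) ℤ.+ + j)

    reindex : ∀ j → j < suc p →
      f j ≡ extendByZero (F (suc a ℕ.+ (p ∸ j)) j) ((q ⊖ p) ℤ.+ + j)
    reindex j (ℕ.s≤s j≤p)
      rewrite ℕ.+-∸-assoc 1 j≤p | ℕ.+-suc a (p ∸ j) | ℤ.[1+m]⊖[1+n]≡m⊖n q p = ≡.refl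

    last : f (suc p) ≡ F a (suc p) (suc q)
    last rewrite ℕ.n∸n≡0 p | ℕ.+-identityʳ a | m⊖n+n≡m (suc q) (suc p) = ≡.refl

  -- Polynomials, synthetic division and Vieta's formulas

  -- c₀ yᴺ + c₁ yᴺ⁻¹ + ⋯ + c_N
  horner : (ℕ → Carrier) → ℕ → Carrier → Carrier
  horner c zero    y = c 0
  horner c (suc N) y = horner c N y * y + c (suc N)

  horner-cong : ∀ {c d} → (∀ k → c k ≈ d k) → ∀ N y → horner c N y ≈ horner d N y
  horner-cong c≈d zero    y = c≈d 0
  horner-cong c≈d (suc N) y = +-cong (*-congʳ (horner-cong c≈d N y)) (c≈d (suc N))

  horner-+ : ∀ c d N y → horner (λ k → c k + d k) N y ≈ horner c N y + horner d N y
  horner-+ c d zero    y = ≈-refl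
  horner-+ c d (suc N) y = ≈-trans (+-congʳ (*-congʳ (horner-+ c d N y)))
    (solve 5 (λ a b y c d → (a :+ b) :* y :+ (c :+ d) := (a :* y :+ c) :+ (b :* y :+ d))
       ≈-refl _ _ _ _ _)

  -- `horner` splits off the constant coefficient; the binomial theorem and the cancellation of Yⁿ
  -- need the leading one.
  horner-suc : ∀ c N y → horner c (suc N) y ≈ c 0 * y ^ suc N + horner (λ k → c (suc k)) N y
  horner-suc c zero    y = +-congʳ (*-congˡ (sym (*-identityʳ y)))
  horner-suc c (suc N) y = ≈-trans (+-congʳ (*-congʳ (horner-suc c N y)))
    (solve 5 (λ a b y h c → (a :* b :+ h) :* y :+ c := a :* (y :* b) :+ (h :* y :+ c))
       ≈-refl _ _ _ _ _)

  horner-binomial : ∀ n y → horner (λ k → (n C k) × 1#) n y ≈ (1# + y) ^ n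
  horner-binomial zero    y = ≈-trans (×-congˡ (nC0≡1 0)) (+-identityʳ 1#)
  horner-binomial (suc n) y = begin
    horner (g (suc n)) (suc n) y
      ≈⟨ horner-suc (g (suc n)) n y ⟩
    g (suc n) 0 * y ^ suc n + horner (λ k → g (suc n) (suc k)) n y
      ≈⟨ +-cong (*-congʳ (×-congˡ (≡.trans (nC0≡1 (suc n)) (≡.sym (nC0≡1 n)))))
                (≈-trans (horner-cong pascal n y) (horner-+ (g n) (λ k → g n (suc k)) n y)) ⟩
    g n 0 * y ^ suc n + (horner (g n) n y + horner (λ k → g n (suc k)) n y)
      ≈⟨ solve 3 (λ a b c → a :+ (b :+ c) := b :+ (a :+ c)) ≈-refl _ _ _ ⟩
    horner (g n) n y + (g n 0 * y ^ suc n + horner (λ k → g n (suc k)) n y)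
      ≈⟨ +-congˡ (horner-suc (g n) n y) ⟨
    horner (g n) n y + (horner (g n) n y * y + g n (suc n))
      -- The shifted row runs one entry past its end, where C(n, n + 1) = 0.
      ≈⟨ +-congˡ (+-congˡ (×-congˡ (k>n⇒nCk≡0 (ℕ.n<1+n n)))) ⟩
    horner (g n) n y + (horner (g n) n y * y + 0#)
      ≈⟨ solve 2 (λ h y → h :+ (h :* y :+ con 0) := (con 1 :+ y) :* h) ≈-refl _ y ⟩
    (1# + y) * horner (g n) n y
      ≈⟨ *-congˡ (horner-binomial n y) ⟩
    (1# + y) ^ suc n ∎
    where
    g : ℕ → ℕ → Carrier
    g n k = (n C k) × 1#

    pascal : ∀ k → g (suc n) (suc k) ≈ g n k + g n (suc k)
    pascal k = ≈-trans (×-congˡ (≡.sym (nCk+nC[k+1]≡[n+1]C[k+1] n k))) (×-homo-+ 1# (n C k) _)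

  -- The coefficients of the quotient on division by Y + x; the entry after the
  -- last one is the remainder.
  deflate : (ℕ → Carrier) → Carrier → ℕ → Carrier
  deflate c x zero    = c 0
  deflate c x (suc k) = c (suc k) - x * deflate c x k

  deflate-suc : ∀ c x k → c (suc k) ≈ deflate c x (suc k) + x * deflate c x k
  deflate-suc c x k = sym (≈-trans (+-assoc _ _ _) (≈-trans (+-congˡ (-‿inverseˡ _)) (+-identityʳ _)))

  horner-deflate : ∀ c x N y →
    horner c (suc N) y ≈ horner (deflate c x) N y * (y + x) + deflate c x (suc N)
  horner-deflate c x zero y = ≈-trans (+-congˡ (deflate-suc c x 0))
    (solve 4 (λ a y x d → a :* y :+ (d :+ x :* a) := a :* (y :+ x) :+ d) ≈-refl _ _ _ _)
  horner-deflate c x (suc N) y =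
    ≈-trans (+-cong (*-congʳ (horner-deflate c x N y)) (deflate-suc c x (suc N)))
    (solve 5 (λ h y x d e → (h :* (y :+ x) :+ d) :* y :+ (e :+ x :* d)
       := (h :* y :+ d) :* (y :+ x) :+ e) ≈-refl _ _ _ _ _)

  horner-deflate-root : ∀ c x N → horner c (suc N) (- x) ≈ 0# → deflate c x (suc N) ≈ 0#
  horner-deflate-root c x N root = begin
    deflate c x (suc N)                ≈⟨ +-identityˡ _ ⟨
    0# + deflate c x (suc N)           ≈⟨ +-congʳ (zeroʳ h) ⟨
    h * 0# + deflate c x (suc N)       ≈⟨ +-congʳ (*-congˡ (-‿inverseˡ x)) ⟨
    h * (- x + x) + deflate c x (suc N) ≈⟨ horner-deflate c x N (- x) ⟨
    horner c (suc N) (- x)             ≈⟨ root ⟩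
    0#                                 ∎
    where h = horner (deflate c x) N (- x)

  -- At -s the linear factor Y + x takes the value x - s, and apartness supplies the inverse that
  -- cancels it.
  deflate-roots : ∀ c x s N → x # s →
    horner c (suc N) (- x) ≈ 0# → horner c (suc N) (- s) ≈ 0# →
    horner (deflate c x) N (- s) ≈ 0#
  deflate-roots c x s N x#s rootₓ rootₛ = begin
    h                          ≈⟨ *-identityʳ h ⟨
    h * 1#                     ≈⟨ *-congˡ (proj₂ (proj₂ (#⇒invertible x#s))) ⟨
    h * ((x - s) * v)          ≈⟨ *-congˡ (*-congʳ (+-comm x (- s))) ⟩
    h * ((- s + x) * v)        ≈⟨ *-assoc h _ v ⟨
    h * (- s + x) * v          ≈⟨ *-congʳ (+-identityʳ _) ⟨
    (h * (- s + x) + 0#) * v   ≈⟨ *-congʳ (+-congˡ (horner-deflate-root c x N rootₓ)) ⟨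
    (h * (- s + x) + deflate c x (suc N)) * v ≈⟨ *-congʳ (horner-deflate c x N (- s)) ⟨
    horner c (suc N) (- s) * v ≈⟨ *-congʳ rootₛ ⟩
    0# * v                     ≈⟨ zeroˡ v ⟩
    0#                         ∎
    where
    h = horner (deflate c x) N (- s)
    v = recip x#s

  elementary>length : ∀ xs → elementary (suc (length xs)) xs ≈ 0#
  elementary>length xs = go (suc (length xs)) xs ℕ.≤-refl
    where
    -- Removing an element lowers k in only one of the two summands, so the induction needs every k
    -- above the length.
    go : ∀ k xs → length xs < k → elementary k xs ≈ 0#
    go (suc k) []       _           = ≈-refl
    go (suc k) (x ∷ xs) (ℕ.s≤s l<k) = begin
      elementary (suc k) xs + x * elementary k xs
        ≈⟨ +-cong (go (suc k) xs (ℕ.m<n⇒m<1+n l<k)) (*-congˡ (go k xs l<k)) ⟩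
      0# + x * 0# ≈⟨ +-identityˡ _ ⟩
      x * 0#      ≈⟨ zeroʳ x ⟩
      0#          ∎

  -- Deflation by `x` keeps the leading coefficient and the other roots, and `deflate-suc` mirrors
  -- the recursion of `elementary`. As the roots are -x, no signs appear; as c₀ stays a factor,
  -- nothing is divided by it.
  vieta : ∀ xs c → AllPairs _#_ xs → All (λ x → horner c (length xs) (- x) ≈ 0#) xs →
          ∀ k → k ≤ length xs → c k ≈ elementary k xs * c 0
  vieta xs       c _           _              zero    _ = sym (*-identityˡ _)
  vieta (x ∷ xs) c (x# ∷ xs#) (root ∷ roots) (suc k) (ℕ.s≤s k≤) = begin
    c (suc k)
      ≈⟨ deflate-suc c x k ⟩
    d (suc k) + x * d k
      ≈⟨ +-cong (next (ℕ.m≤n⇒m<n∨m≡n k≤)) (*-congˡ (ih k k≤)) ⟩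
    elementary (suc k) xs * c 0 + x * (elementary k xs * c 0)
      ≈⟨ solve 4 (λ a b x c → a :* c :+ x :* (b :* c) := (a :+ x :* b) :* c) ≈-refl _ _ x _ ⟩
    elementary (suc k) (x ∷ xs) * c 0 ∎
    where
    d = deflate c x

    ih : ∀ k → k ≤ length xs → d k ≈ elementary k xs * c 0
    ih = vieta xs d xs#
      (All.zipWith (λ { {s} (x#s , rootₛ) → deflate-roots c x s (length xs) x#s root rootₛ })
                   (x# , roots))

    next : k < length xs ⊎ k ≡ length xs → d (suc k) ≈ elementary (suc k) xs * c 0
    next (inj₁ k<)     = ih (suc k) k<
    -- Here `d (suc k)` is the remainder, out of reach of the induction hypothesis; both sides are
    -- 0.
    next (inj₂ ≡.refl) = ≈-trans (horner-deflate-root c x (length xs) root)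
      (sym (≈-trans (*-congʳ (elementary>length xs)) (zeroˡ _)))

  -- The numbers (1 - ζⁱ)⁻¹ for n = N + 1

  module _ {N : ℕ} {ζ : Carrier} (ζ-prim : IsPrimitiveRoot (suc N) ζ) where
    open IsPrimitiveRoot ζ-prim
    open MultipleSums ζ-prim

    exponent : Fin N → ℕ
    exponent k = suc (toℕ k)

    term-inverseˡ : ∀ k → term k * (1# - ζ ^ exponent k) ≈ 1#
    term-inverseˡ k = proj₁ (proj₂ (#⇒invertible _))

    1ⁿ≈1 : ∀ n → 1# ^ n ≈ 1#
    1ⁿ≈1 zero    = ≈-refl
    1ⁿ≈1 (suc n) = ≈-trans (*-identityˡ _) (1ⁿ≈1 n)

    ζⁱ^n≈1 : ∀ i → (ζ ^ i) ^ suc N ≈ 1#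
    ζⁱ^n≈1 i = begin
      (ζ ^ i) ^ suc N   ≈⟨ ^-assocʳ ζ i (suc N) ⟩
      ζ ^ (i ℕ.* suc N) ≡⟨ ≡.cong (ζ ^_) (ℕ.*-comm i (suc N)) ⟩
      ζ ^ (suc N ℕ.* i) ≈⟨ ^-assocʳ ζ (suc N) i ⟨
      (ζ ^ suc N) ^ i   ≈⟨ ^-congˡ i ζⁿ≈1 ⟩
      1# ^ i            ≈⟨ 1ⁿ≈1 i ⟩
      1#                ∎

    coefficient : ℕ → Carrier
    coefficient k = (suc N C suc k) × 1#

    term-root : ∀ k → horner coefficient N (- term k) ≈ 0#
    -- Adding Yⁿ completes the row of binomial coefficients; it is cancelled at the end.
    term-root k = +-identityʳ-unique (y ^ suc N) _ (begin
      y ^ suc N + horner coefficient N y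
        ≈⟨ +-congʳ (*-identityˡ _) ⟨
      1# * y ^ suc N + horner coefficient N y
        ≈⟨ +-congʳ (*-congʳ (≈-trans (×-congˡ (nC0≡1 (suc N))) (+-identityʳ 1#))) ⟨
      (suc N C 0) × 1# * y ^ suc N + horner coefficient N y
        ≈⟨ horner-suc (λ k → (suc N C k) × 1#) N y ⟨
      horner (λ k → (suc N C k) × 1#) (suc N) y
        ≈⟨ horner-binomial (suc N) y ⟩
      (1# + y) ^ suc N
        ≈⟨ ^-congˡ (suc N) 1+y≈yz ⟩
      (y * z) ^ suc N
        ≈⟨ ^-distrib-* y z (suc N) ⟩
      y ^ suc N * z ^ suc N
        ≈⟨ *-congˡ (ζⁱ^n≈1 (exponent k)) ⟩
      y ^ suc N * 1#
        ≈⟨ *-identityʳ _ ⟩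
      y ^ suc N ∎)
      where
      t = term k
      y = - t
      z = ζ ^ exponent k

      1+y≈yz : 1# + y ≈ y * z
      1+y≈yz = begin
        1# + - t                  ≈⟨ +-congʳ (term-inverseˡ k) ⟨
        t * (1# - z) + - t        ≈⟨ +-congʳ (x[y-z]≈xy-xz t 1# z) ⟩
        (t * 1# - t * z) + - t    ≈⟨ +-comm _ _ ⟩
        - t + (t * 1# - t * z)    ≈⟨ +-assoc _ _ _ ⟨
        (- t + t * 1#) - t * z    ≈⟨ +-congʳ (+-congˡ (*-identityʳ t)) ⟩
        (- t + t) - t * z         ≈⟨ +-congʳ (-‿inverseˡ t) ⟩
        0# - t * z                ≈⟨ +-identityˡ _ ⟩
        - (t * z)                 ≈⟨ -‿distribˡ-* t z ⟩
        - t * z                   ∎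

    -- 1/p - 1/q = (q - p)/(pq) and q - p = a (1 - ζᵈ) with 0 < d < n, so every factor is
    -- invertible.
    term-# : ∀ {i j} → i Fin.< j → term i # term j
    term-# {i} {j} i<j =
      invertible⇒# (v , ≈-trans (*-comm v _) inverse , inverse)
      where
      d = toℕ j ∸ toℕ i
      a = ζ ^ exponent i
      w = ζ ^ d
      x = term i
      s = term j
      p = 1# - a
      q = 1# - ζ ^ exponent j
      1#w = #-sym (ζⁱ#1 d (ℕ.m<n⇒0<n∸m i<j)
              (ℕ.≤-<-trans (ℕ.m∸n≤m (toℕ j) (toℕ i)) (ℕ.m<n⇒m<1+n (toℕ<n j))))
      r = 1# - w
      r⁻¹ = recip 1#w
      -- `a ^ N` is the inverse of `a`, because `a ^ suc N` is 1.
      v = p * q * (a ^ N * r⁻¹)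

      inverse : (x - s) * v ≈ 1#
      inverse = begin
        (x - s) * (p * q * (a ^ N * r⁻¹))   ≈⟨ *-assoc (x - s) (p * q) _ ⟨
        (x - s) * (p * q) * (a ^ N * r⁻¹)   ≈⟨ *-congʳ difference ⟩
        a * r * (a ^ N * r⁻¹)
          ≈⟨ solve 4 (λ a r b t → a :* r :* (b :* t) := (a :* b) :* (r :* t))
               ≈-refl a r (a ^ N) r⁻¹ ⟩
        a ^ suc N * (r * r⁻¹)
          ≈⟨ *-cong (ζⁱ^n≈1 (exponent i)) (proj₂ (proj₂ (#⇒invertible 1#w))) ⟩
        1# * 1#                             ≈⟨ *-identityˡ 1# ⟩
        1#                                  ∎
        where
        q≈p+ar : q ≈ p + a * r
        q≈p+ar = begin
          1# - ζ ^ exponent j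
            ≡⟨ ≡.cong (λ e → 1# - ζ ^ suc e) (ℕ.m+[n∸m]≡n (ℕ.<⇒≤ i<j)) ⟨
          1# - ζ ^ (exponent i ℕ.+ d)       ≈⟨ +-congˡ (-‿cong (^-homo-* ζ (exponent i) d)) ⟩
          1# - a * w                        ≈⟨ +-congʳ (+-identityʳ 1#) ⟨
          (1# + 0#) - a * w                 ≈⟨ +-congʳ (+-congˡ (-‿inverseˡ a)) ⟨
          (1# + (- a + a)) - a * w
            ≈⟨ solve 4 (λ o m a n → (o :+ (m :+ a)) :+ n := (o :+ m) :+ (a :+ n))
                 ≈-refl 1# (- a) a (- (a * w)) ⟩
          p + (a - a * w)                   ≈⟨ +-congˡ (+-congʳ (*-identityʳ a)) ⟨
          p + (a * 1# - a * w)              ≈⟨ +-congˡ (x[y-z]≈xy-xz a 1# w) ⟨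
          p + a * r                         ∎

        difference : (x - s) * (p * q) ≈ a * r
        difference = begin
          (x - s) * (p * q)                 ≈⟨ [y-z]x≈yx-zx (p * q) x s ⟩
          x * (p * q) - s * (p * q)
            ≈⟨ +-cong (solve 3 (λ x p q → x :* (p :* q) := (x :* p) :* q) ≈-refl x p q)
                 (-‿cong (solve 3 (λ s p q → s :* (p :* q) := (s :* q) :* p) ≈-refl s p q)) ⟩
          (x * p) * q - (s * q) * p
            ≈⟨ +-cong (*-congʳ (term-inverseˡ i)) (-‿cong (*-congʳ (term-inverseˡ j))) ⟩
          1# * q - 1# * p                   ≈⟨ +-cong (*-identityˡ q) (-‿cong (*-identityˡ p)) ⟩
          q - p                             ≈⟨ +-congʳ (≈-trans q≈p+ar (+-comm p (a * r))) ⟩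
          (a * r + p) - p                   ≈⟨ +-assoc _ _ _ ⟩
          a * r + (p - p)                   ≈⟨ +-congˡ (-‿inverseʳ p) ⟩
          a * r + 0#                        ≈⟨ +-identityʳ _ ⟩
          a * r                             ∎

    terms : List Carrier
    terms = map term (allFin N)

    length-terms : length terms ≡ N
    length-terms = ≡.trans (length-map term (allFin N)) (length-tabulate (λ i → i))

    elementary-terms : ∀ k → k ≤ N → coefficient k ≈ elementary k terms * (suc N × 1#)
    elementary-terms k k≤N = begin
      coefficient k
        ≈⟨ vieta terms coefficient (AllPairs.map⁺ (AllPairs.tabulate⁺-< term-#))
             (All.map⁺ (All.tabulate⁺ λ i →
               ≡.subst (λ n → horner coefficient n (- term i) ≈ 0#)
                       (≡.sym length-terms) (term-root i)))
             k (≡.subst (k ≤_) (≡.sym length-terms) k≤N) ⟩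
      elementary k terms * (suc N C 1) × 1#
        ≈⟨ *-congˡ (×-congˡ (nC1≡n (suc N))) ⟩
      elementary k terms * (suc N × 1#) ∎

    𝒴-monomial : ∀ a b → 𝒴 (2ᵃ1ᵇ a b) ≈ monomial a b terms
    𝒴-monomial a b = begin
      ∑ (distinctRearrangements (2ᵃ1ᵇ a b)) ℨ
        ≈⟨ ∑-↭ ℨ (distinctRearrangements↭words a b) ⟩
      ∑ (words a b) ℨ
        ≈⟨ ∑-cong (words a b) (λ w → quasiMonomial-combinations term w (allFin N)) ⟩
      ∑ (words a b) (λ w → quasiMonomial w terms)
        ≈⟨ ∑-words a b terms ⟩
      monomial a b terms ∎

    -- Evaluation of the sum

    ·-zeroʳ : ∀ k → k · 0# ≈ 0#
    ·-zeroʳ (+ k)    = ×-zeroʳ k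
    ·-zeroʳ -[1+ k ] = ≈-trans (-‿cong (×-zeroʳ (suc k))) -0#≈0#

    -- For negative k there are two cases. If k + j < 0, the block of ones has negative length and
    -- `𝒴` is 0; otherwise 0 ≤ k + j < j and the binomial coefficient is 0.
    binomial-𝒴 : ∀ a j k → binomial (k ℤ.+ + j) j · 𝒴[2^ + a ,1^ k ℤ.+ + j ]
                   ≈ extendByZero (productTerm terms a j) k
    binomial-𝒴 a j (+ k) = begin
      ((k ℕ.+ j) C j) × 𝒴 (2ᵃ1ᵇ a (k ℕ.+ j)) ≈⟨ ×-congʳ ((k ℕ.+ j) C j) (𝒴-monomial a (k ℕ.+ j)) ⟩
      ((k ℕ.+ j) C j) × monomial a (k ℕ.+ j) terms
        ≡⟨ ≡.cong (λ b → (b C j) × monomial a b terms) (ℕ.+-comm k j) ⟩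
      productTerm terms a j k ∎
    binomial-𝒴 a j -[1+ k ] with suc k ℕ.≤? j
    ... | no  k≰j rewrite ℤ.⊖-< (ℕ.≰⇒> k≰j) | ℕ.+-∸-assoc 1 (ℕ.≤-pred (ℕ.≰⇒> k≰j)) =
      ·-zeroʳ (binomial -[1+ k ∸ j ] j)
    ... | yes k<j rewrite ℤ.⊖-≥ k<j
                        | k>n⇒nCk≡0 (ℕ.∸-monoʳ-< {j} {suc k} {0} ℕ.z<s k<j) = ≈-refl

    -- Introducing p and q through equations keeps truncated subtraction out of the integer indices.
    ∑-binomial-𝒴 : ∀ m ℓ p q → p ℕ.+ m ≡ N → q ℕ.+ ℓ ≡ N →
      (∑[ j ∈ upTo (suc p) ]
         binomial (+ m ℤ.- + ℓ ℤ.+ + (2 ℕ.* j)) j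
           · 𝒴[2^ + suc N ℤ.- + m ℤ.- + j ℤ.- 1ℤ ,1^ + m ℤ.- + ℓ ℤ.+ + (2 ℕ.* j) ])
      ≈ elementary p terms * elementary q terms
    ∑-binomial-𝒴 m ℓ p q p+m≡N q+ℓ≡N = begin
      _ ≈⟨ ∑-upTo-cong (suc p) (λ j j<1+p → ≈-reflexive
             (≡.cong₂ (λ a b → binomial b j · 𝒴[2^ a ,1^ b ])
                (≡.subst (λ N → + suc N ℤ.- + m ℤ.- + j ℤ.- 1ℤ ≡ + (p ∸ j)) p+m≡N
                   (upperIndex m p j (ℕ.≤-pred j<1+p)))
                (lowerIndex m ℓ p q j (≡.trans p+m≡N (≡.sym q+ℓ≡N))))) ⟩
      ∑ (upTo (suc p)) (λ j → let b = (q ⊖ p) ℤ.+ + j ℤ.+ + j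
                              in binomial b j · 𝒴[2^ + (p ∸ j) ,1^ b ])
        ≈⟨ ∑-cong (upTo (suc p)) (λ j → binomial-𝒴 (p ∸ j) j ((q ⊖ p) ℤ.+ + j)) ⟩
      _ ≈⟨ diagonalSum-∑ (productTerm terms) 0 p q ⟩
      diagonalSum (productTerm terms) 0 p q
        ≈⟨ elementary-* terms p q ⟨
      elementary p terms * elementary q terms ∎

    theorem7-suc : (char0 : CharacteristicZero) (0<n : 0 < suc N) → ∀ m ℓ → m ≤ N → ℓ ≤ N →
      let n⁻¹ = recip (char0 (suc N) 0<n)
      in (∑[ j ∈ upTo (suc N ∸ m) ]
            binomial (+ m ℤ.- + ℓ ℤ.+ + (2 ℕ.* j)) j
              · 𝒴[2^ + suc N ℤ.- + m ℤ.- + j ℤ.- 1ℤ ,1^ + m ℤ.- + ℓ ℤ.+ + (2 ℕ.* j) ])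
         ≈ n⁻¹ ^ 2 * ((suc N C m) ℕ.* (suc N C ℓ)) × 1#
    theorem7-suc char0 0<n m ℓ m≤N ℓ≤N = begin
      ∑ (upTo (suc N ∸ m)) f
        ≡⟨ ≡.cong (λ k → ∑ (upTo k) f) (ℕ.+-∸-assoc 1 m≤N) ⟩
      ∑ (upTo (suc (N ∸ m))) f
        ≈⟨ ∑-binomial-𝒴 m ℓ (N ∸ m) (N ∸ ℓ) (ℕ.m∸n+n≡m m≤N) (ℕ.m∸n+n≡m ℓ≤N) ⟩
      e (N ∸ m) * e (N ∸ ℓ)
        ≈⟨ *-cong (evaluate m m≤N) (evaluate ℓ ℓ≤N) ⟩
      (n⁻¹ * (suc N C m) × 1#) * (n⁻¹ * (suc N C ℓ) × 1#)
        ≈⟨ solve 3 (λ n a b → (n :* a) :* (n :* b) := n :* (n :* con 1) :* (a :* b)) ≈-refl n⁻¹ _ _ ⟩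
      n⁻¹ ^ 2 * ((suc N C m) × 1# * (suc N C ℓ) × 1#)
        ≈⟨ *-congˡ (×1-homo-* (suc N C m) (suc N C ℓ)) ⟨
      n⁻¹ ^ 2 * ((suc N C m) ℕ.* (suc N C ℓ)) × 1# ∎
      where
      n⁻¹ = recip (char0 (suc N) 0<n)
      e = λ k → elementary k terms
      f = λ j → binomial (+ m ℤ.- + ℓ ℤ.+ + (2 ℕ.* j)) j
            · 𝒴[2^ + suc N ℤ.- + m ℤ.- + j ℤ.- 1ℤ ,1^ + m ℤ.- + ℓ ℤ.+ + (2 ℕ.* j) ]

      n⁻¹*n≈1 : n⁻¹ * suc N × 1# ≈ 1#
      n⁻¹*n≈1 = begin
        -- `recip` inverts the difference of its two sides, here n - 0.
        n⁻¹ * suc N × 1#        ≈⟨ *-congˡ (+-identityʳ _) ⟨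
        n⁻¹ * (suc N × 1# + 0#) ≈⟨ *-congˡ (+-congˡ -0#≈0#) ⟨
        n⁻¹ * (suc N × 1# - 0#) ≈⟨ proj₁ (proj₂ (#⇒invertible (char0 (suc N) 0<n))) ⟩
        1#                      ∎

      evaluate : ∀ m → m ≤ N → e (N ∸ m) ≈ n⁻¹ * (suc N C m) × 1#
      evaluate m m≤N = begin
        e (N ∸ m)                            ≈⟨ *-identityˡ _ ⟨
        1# * e (N ∸ m)                       ≈⟨ *-congʳ n⁻¹*n≈1 ⟨
        n⁻¹ * suc N × 1# * e (N ∸ m)
          ≈⟨ solve 3 (λ n a b → n :* a :* b := n :* (b :* a)) ≈-refl n⁻¹ _ _ ⟩
        n⁻¹ * (e (N ∸ m) * suc N × 1#)
          ≈⟨ *-congˡ (elementary-terms (N ∸ m) (ℕ.m∸n≤m N m)) ⟨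
        n⁻¹ * (suc N C suc (N ∸ m)) × 1#
          -- The lower index N - m + 1 is n - m, so symmetry turns the coefficient into C(n, m).
          ≡⟨ ≡.cong (λ k → n⁻¹ * (suc N C k) × 1#) (ℕ.+-∸-assoc 1 m≤N) ⟨
        n⁻¹ * (suc N C (suc N ∸ m)) × 1#
          ≡⟨ ≡.cong (λ k → n⁻¹ * k × 1#) (nCk≡nC[n∸k] (ℕ.m≤n⇒m≤1+n m≤N)) ⟨
        n⁻¹ * (suc N C m) × 1#               ∎

theorem7 : ∀ {c ℓ₁ ℓ₂} (K : HeytingField c ℓ₁ ℓ₂) →
  let open HeytingField K
      open FieldDefs K
  in (char0 : CharacteristicZero) →
     (n m ℓ : ℕ) (0<n : 0 < n) → 0 < m → 0 < ℓ → m ≤ n ∸ 1 → ℓ ≤ n ∸ 1 →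
     (ζ : Carrier) (ζ-prim : IsPrimitiveRoot n ζ) →
  let open MultipleSums ζ-prim
      n⁻¹ = recip (char0 n 0<n)
  in (∑[ j ∈ upTo (n ∸ m) ]
        binomial (+ m ℤ.- + ℓ ℤ.+ + (2 ℕ.* j)) j
          · 𝒴[2^ + n ℤ.- + m ℤ.- + j ℤ.- 1ℤ ,1^ + m ℤ.- + ℓ ℤ.+ + (2 ℕ.* j) ])
     ≈ n⁻¹ ^ 2 * ((n C m) ℕ.* (n C ℓ)) × 1#
theorem7 K char0 zero    m ℓ ()
theorem7 K char0 (suc N) m ℓ 0<n _ _ m≤N ℓ≤N ζ ζ-prim =
  theorem7-suc K ζ-prim char0 0<n m ℓ m≤N ℓ≤N
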